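{- Let $X\in\mathbb{R}^{m\times n}$ be a matrix whose columns have unit Euclidean norm and let $Y\in\mathbb{R}^{m\times\ell}$. Then the Sparse Multiple Linear Regression objective $f:2^{[n]}\to\mathbb{R}_+$, $f(S)=\|Y-X_SX_S^{+}Y\|_F^2$, is weakly-$\alpha$-supermodular with $$\alpha=\max_{S'}\|X_{S'}^{+}\|_2^2,$$ the maximum being over all nonempty $S'\subseteq[n]$.
   Context: $[n]=\{1,\dots,n\}$ and $\mathbb{R}_+$ is the set of non-negative reals. For $S\subseteq[n]$, $X_S$ is the submatrix of $X$ formed by the columns indexed by $S$, and $X_S^{+}$ is its Moore–Penrose pseudo-inverse; for $S=\emptyset$ the product $X_SX_S^{+}$ is read as $0$. $\|\cdot\|_F$ is the Frobenius norm and $\|\cdot\|_2$ the spectral norm. A set function $f:2^{[n]}\to\mathbb{R}_+$ is non-increasing if $f(S\cup T)\le f(S)$ for all $S,T\subseteq[n]$. A non-negative non-increasing set function $f$ is weakly-$\alpha$-supermodular, where $\alpha\ge 1$, if for all $S,T\subseteq[n]$ $$f(S)-f(S\cup T)\le \alpha\cdot|T\setminus S|\cdot\max_{i\in T\setminus S}[f(S)-f(S\cup\{i\})],$$ where the right-hand side is read as $0$ when $T\setminus S=\emptyset$. -}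

module Defs where

open import Level using (Level; _⊔_) renaming (suc to lsuc)
open import Algebra.Bundles using (CommutativeRing)
import Algebra.Construct.NaturalChoice.Max as Max
import Algebra.Definitions.RawMonoid as RawMonoidDefinitions
open import Data.Fin.Base using (Fin; zero; suc)
open import Data.Fin.Subset using (Subset; inside; outside; ∣_∣; _∪_; _─_; ⁅_⁆)
open import Data.Nat.Base using (ℕ; zero; suc)
open import Data.Product.Base using (∃; _×_)
open import Data.Vec.Base using (_∷_)
open import Data.Vec.Functional using (Vector; foldr; head; tail)
open import Relation.Binary.Bundles using (DecTotalOrder; TotalOrder)
open import Relation.Binary.Core using (Rel)
open import Relation.Binary.Structures using (IsDecTotalOrder)
open import Relation.Nullary.Negation using (¬_)

module _ {c ℓ : Level} {A : Set c} (_≤_ : Rel A ℓ) where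

  IsUpperBound : {p : Level} → (A → Set p) → A → Set (c ⊔ ℓ ⊔ p)
  IsUpperBound P u = ∀ x → P x → x ≤ u

  IsSupremum : {p : Level} → (A → Set p) → A → Set (c ⊔ ℓ ⊔ p)
  IsSupremum P s = IsUpperBound P s × (∀ u → IsUpperBound P u → s ≤ u)

  IsMaximum : {p : Level} → (A → Set p) → A → Set (c ⊔ ℓ ⊔ p)
  IsMaximum P s = P s × IsUpperBound P s

-- The real numbers, given axiomatically as a Dedekind-complete ordered field.
-- These axioms determine ℝ up to unique isomorphism in classical mathematics,
-- and are meant classically: completeness for arbitrary predicates together
-- with a decidable total order has no model without excluded middle.
record CompleteOrderedField (c ℓ₁ ℓ₂ : Level) : Set (lsuc (c ⊔ ℓ₁ ⊔ ℓ₂)) where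
  field
    commutativeRing : CommutativeRing c ℓ₁

  open CommutativeRing commutativeRing public

  infix 4 _≤_
  field
    _≤_             : Rel Carrier ℓ₂
    isDecTotalOrder : IsDecTotalOrder _≈_ _≤_
    0≉1             : ¬ (0# ≈ 1#)
    inverse         : ∀ x → ¬ (x ≈ 0#) → ∃ λ y → x * y ≈ 1#
    +-monoˡ-≤       : ∀ z {x y} → x ≤ y → x + z ≤ y + z
    *-nonNegative   : ∀ {x y} → 0# ≤ x → 0# ≤ y → 0# ≤ x * y
    complete        : (P : Carrier → Set (c ⊔ ℓ₁ ⊔ ℓ₂)) →
                      ∃ P → ∃ (IsUpperBound _≤_ P) → ∃ (IsSupremum _≤_ P)

  decTotalOrder : DecTotalOrder c ℓ₁ ℓ₂
  decTotalOrder = record { isDecTotalOrder = isDecTotalOrder }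

  totalOrder : TotalOrder c ℓ₁ ℓ₂
  totalOrder = DecTotalOrder.totalOrder decTotalOrder

-- The increasing enumeration of the elements of a subset.
element : {n : ℕ} (S : Subset n) → Fin ∣ S ∣ → Fin n
element (inside  ∷ S) zero    = zero
element (inside  ∷ S) (suc i) = suc (element S i)
element (outside ∷ S) i       = suc (element S i)

module LinearAlgebra {c ℓ₁ ℓ₂ : Level} (ℝ : CompleteOrderedField c ℓ₁ ℓ₂) where

  open CompleteOrderedField ℝ
  open RawMonoidDefinitions +-rawMonoid using (sum) renaming (_×_ to _·_)
  module ℝ-Max = Max totalOrder

  Matrix : ℕ → ℕ → Set c
  Matrix m n = Fin m → Fin n → Carrier

  infix 4 _≋_
  _≋_ : {m n : ℕ} → Matrix m n → Matrix m n → Set ℓ₁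
  A ≋ B = ∀ i j → A i j ≈ B i j

  infixl 7 _⊗_
  _⊗_ : {m n k : ℕ} → Matrix m n → Matrix n k → Matrix m k
  (A ⊗ B) i j = sum (λ t → A i t * B t j)

  infixl 6 _⊖_
  _⊖_ : {m n : ℕ} → Matrix m n → Matrix m n → Matrix m n
  (A ⊖ B) i j = A i j - B i j

  infix 8 _ᵀ
  _ᵀ : {m n : ℕ} → Matrix m n → Matrix n m
  (A ᵀ) i j = A j i

  infixr 7 _⊛_
  _⊛_ : {m n : ℕ} → Matrix m n → Vector Carrier n → Vector Carrier m
  (A ⊛ v) i = sum (λ t → A i t * v t)

  column : {m n : ℕ} → Matrix m n → Fin n → Vector Carrier m
  column A j i = A i j

  -- For S = ∅ this has no columns, so any product X_S ⊗ B is the zero matrix.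
  columns : {m n : ℕ} → Matrix m n → (S : Subset n) → Matrix m ∣ S ∣
  columns X S i j = X i (element S j)

  -- IsNorm v r states ‖v‖₂ = r, i.e. r is the non-negative square root of Σ vᵢ².
  IsNorm : {n : ℕ} → Vector Carrier n → Carrier → Set (ℓ₁ ⊔ ℓ₂)
  IsNorm v r = 0# ≤ r × r * r ≈ sum (λ i → v i * v i)

  -- ‖A‖_F²
  frobenius² : {m n : ℕ} → Matrix m n → Carrier
  frobenius² A = sum (λ i → sum (λ j → A i j * A i j))

  -- ‖A‖₂ = s, the supremum of ‖Av‖₂ over unit vectors v.
  IsSpectralNorm : {m n : ℕ} → Matrix m n → Carrier → Set (c ⊔ ℓ₁ ⊔ ℓ₂)
  IsSpectralNorm A = IsSupremum _≤_ (λ r → ∃ λ v → IsNorm v 1# × IsNorm (A ⊛ v) r)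

  -- The four Penrose equations; they determine P uniquely.
  record IsPseudoInverse {m n : ℕ} (A : Matrix m n) (P : Matrix n m) : Set ℓ₁ where
    field
      APA≋A        : A ⊗ P ⊗ A ≋ A
      PAP≋P        : P ⊗ A ⊗ P ≋ P
      AP-symmetric : (A ⊗ P) ᵀ ≋ A ⊗ P
      PA-symmetric : (P ⊗ A) ᵀ ≋ P ⊗ A

  maximumOrZero : {n : ℕ} → Vector Carrier n → Carrier
  maximumOrZero {zero}  v = 0#
  maximumOrZero {suc n} v = foldr ℝ-Max._⊔_ (head v) (tail v)

  record WeaklySupermodular {n : ℕ} (α : Carrier) (f : Subset n → Carrier)
                            : Set ℓ₂ where
    field
      1≤α              : 1# ≤ α
      nonNegative      : ∀ S → 0# ≤ f S
      nonIncreasing    : ∀ S T → f (S ∪ T) ≤ f S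
      weakSupermodular : ∀ S T →
        f S - f (S ∪ T) ≤
          α * (∣ T ─ S ∣ · 1#) *
          maximumOrZero (λ k → f S - f (S ∪ ⁅ element (T ─ S) k ⁆))

  -- The objective S ↦ ‖Y − X_S X_S⁺ Y‖_F², where X⁺ S stands for X_S⁺.
  objective : {m n l : ℕ} (X : Matrix m n) (X⁺ : ∀ S → Matrix ∣ S ∣ m) →
              Matrix m l → Subset n → Carrier
  objective X X⁺ Y S = frobenius² (Y ⊖ columns X S ⊗ X⁺ S ⊗ Y)

-- Let Q_S = X_S X_S⁺ be the orthogonal projection onto the span of the columns x_i, i ∈ S,
-- let U = S ∪ T, and let r = y − Q_S y be the residual of a column y of Y.  Since
-- Q_U Q_S = Q_S, the decrease f(S) − f(U) is the sum of the ‖ Q_U r ‖² over the columns y.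
-- As Q_U = (X_U⁺)ᵀ X_Uᵀ, this is at most α Σ_{i ∈ U} ⟨ x_i , r ⟩², where the terms with
-- i ∈ S vanish.  For the other terms, ⟨ x_i , r ⟩² = ⟨ x_i , Q_{S ∪ i} r ⟩² ≤ ‖ Q_{S ∪ i} r ‖²
-- by Cauchy–Schwarz, and the right-hand sides add up over y to f(S) − f(S ∪ i).

module Submission where

open import Defs
open import Level using (Level; _⊔_; Lift; lift)
import Algebra.Properties.Group as GroupProperties
import Algebra.Properties.Semiring.Mult as SemiringMult
import Algebra.Properties.Semiring.Sum as SemiringSum
import Algebra.Solver.Ring.NaturalCoefficients.Default as NaturalSolver
open import Data.Empty using (⊥-elim)
open import Data.Fin.Base using (Fin; zero; suc)
open import Data.Fin.Subset using
  (Subset; Nonempty; inside; outside; ∣_∣; _∈_; _⊆_; _∪_; _─_; ⁅_⁆)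
open import Data.Fin.Subset.Properties using
  (x∈⁅x⁆; ∣⁅x⁆∣≡1; nonempty?; p⊆p∪q; q⊆p∪q)
open import Data.Nat.Base using (ℕ; zero; suc)
open import Data.Product.Base using (∃; _×_; _,_; proj₁; proj₂)
open import Data.Sum.Base using (inj₁; inj₂)
open import Data.Vec.Base using (_∷_; []; here; there)
open import Data.Vec.Functional using (Vector; foldr; head; tail)
open import Function.Base using (_∘_)
open import Relation.Binary.Bundles using (DecTotalOrder)
import Relation.Binary.PropositionalEquality.Core as ≡
open ≡ using (_≡_)
import Relation.Binary.Reasoning.PartialOrder as PartialOrderReasoning
open import Relation.Nullary.Decidable using (Dec; yes; no)
open import Relation.Nullary.Negation using (¬_)

-- Enumerations of finite subsets.

element∈ : {n : ℕ} (S : Subset n) (k : Fin ∣ S ∣) → element S k ∈ S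
element∈ (inside  ∷ S) zero    = here
element∈ (inside  ∷ S) (suc k) = there (element∈ S k)
element∈ (outside ∷ S) k       = there (element∈ S k)

element-surjective : {n : ℕ} (S : Subset n) {i : Fin n} → i ∈ S → ∃ λ k → element S k ≡ i
element-surjective (inside  ∷ S) here        = zero , ≡.refl
element-surjective (inside  ∷ S) (there i∈S) =
  let k , eq = element-surjective S i∈S in suc k , ≡.cong suc eq
element-surjective (outside ∷ S) (there i∈S) =
  let k , eq = element-surjective S i∈S in k , ≡.cong suc eq

-- Ordered-field inequalities and the existence of square roots.

module OrderedField {c ℓ₁ ℓ₂ : Level} (ℝ : CompleteOrderedField c ℓ₁ ℓ₂) where

  open CompleteOrderedField ℝ hiding (zero)
  open DecTotalOrder decTotalOrder public using (total; antisym; _≟_; poset)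
    renaming (refl to ≤-refl; reflexive to ≤-reflexive; trans to ≤-trans)
  open GroupProperties +-group using (∙-cancelʳ)
  open NaturalSolver commutativeSemiring using (solve; _:=_; _:+_; _:*_; con)
  open PartialOrderReasoning poset

  x-y+y≈x : ∀ x y → (x - y) + y ≈ x
  x-y+y≈x x y = trans (+-assoc x (- y) y) (trans (+-congˡ (-‿inverseˡ y)) (+-identityʳ x))

  x≈y+z⇒x-z≈y : ∀ {x y z} → x ≈ y + z → x - z ≈ y
  x≈y+z⇒x-z≈y {x} {y} {z} x≈y+z = ∙-cancelʳ z (x - z) y (trans (x-y+y≈x x z) x≈y+z)

  +-monoʳ-≤ : ∀ z {x y} → x ≤ y → z + x ≤ z + y
  +-monoʳ-≤ z {x} {y} x≤y = begin
    z + x ≈⟨ +-comm z x ⟩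
    x + z ≤⟨ +-monoˡ-≤ z x≤y ⟩
    y + z ≈⟨ +-comm y z ⟩
    z + y ∎

  +-mono-≤ : ∀ {x y u v} → x ≤ y → u ≤ v → x + u ≤ y + v
  +-mono-≤ {y = y} {u = u} x≤y u≤v = ≤-trans (+-monoˡ-≤ u x≤y) (+-monoʳ-≤ y u≤v)

  +-nonNegative : ∀ {x y} → 0# ≤ x → 0# ≤ y → 0# ≤ x + y
  +-nonNegative 0≤x 0≤y = ≤-trans (≤-reflexive (sym (+-identityˡ 0#))) (+-mono-≤ 0≤x 0≤y)

  x≤x+y : ∀ {x y} → 0# ≤ y → x ≤ x + y
  x≤x+y {x} 0≤y = ≤-trans (≤-reflexive (sym (+-identityʳ x))) (+-monoʳ-≤ x 0≤y)

  x+y≈z⇒x≤z : ∀ {x y z} → 0# ≤ y → x + y ≈ z → x ≤ z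
  x+y≈z⇒x≤z 0≤y x+y≈z = ≤-trans (x≤x+y 0≤y) (≤-reflexive x+y≈z)

  +-cancelʳ-≤ : ∀ z {x y} → x + z ≤ y + z → x ≤ y
  +-cancelʳ-≤ z {x} {y} x+z≤y+z = begin
    x           ≈⟨ x≈y+z⇒x-z≈y refl ⟨
    (x + z) - z ≤⟨ +-monoˡ-≤ (- z) x+z≤y+z ⟩
    (y + z) - z ≈⟨ x≈y+z⇒x-z≈y refl ⟩
    y           ∎

  -- Replaces an inequality by an equation with a non-negative difference. The algebra can then be
  -- done without subtraction, which is the form that the commutative semiring solver handles.
  gap : ∀ {x y} → x ≤ y → ∃ λ d → 0# ≤ d × x + d ≈ y
  gap {x} {y} x≤y = y - x ,
    ≤-trans (≤-reflexive (sym (-‿inverseʳ x))) (+-monoˡ-≤ (- x) x≤y) ,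
    trans (+-comm x (y - x)) (x-y+y≈x y x)

  *-monoˡ-≤ : ∀ {z x y} → 0# ≤ z → x ≤ y → z * x ≤ z * y
  *-monoˡ-≤ {z} {x} {y} 0≤z x≤y with d , 0≤d , x+d≈y ← gap x≤y =
    x+y≈z⇒x≤z (*-nonNegative 0≤z 0≤d) (trans (sym (distribˡ z x d)) (*-congˡ x+d≈y))

  *-monoʳ-≤ : ∀ {z x y} → 0# ≤ z → x ≤ y → x * z ≤ y * z
  *-monoʳ-≤ {z} {x} {y} 0≤z x≤y = begin
    x * z ≈⟨ *-comm x z ⟩
    z * x ≤⟨ *-monoˡ-≤ 0≤z x≤y ⟩
    z * y ≈⟨ *-comm z y ⟩
    y * z ∎

  square-nonNegative : ∀ x → 0# ≤ x * x
  square-nonNegative x with total 0# x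
  ... | inj₁ 0≤x = *-nonNegative 0≤x 0≤x
  -- Here d is the negative of x. Both d * d and x * x differ from a common expression only by
  -- multiples of x + d, which vanish.
  ... | inj₂ x≤0 with d , 0≤d , x+d≈0 ← gap x≤0 = begin
    0#                ≤⟨ *-nonNegative 0≤d 0≤d ⟩
    d * d             ≈⟨ +-identityˡ (d * d) ⟨
    0# + d * d        ≈⟨ +-congʳ (zeroʳ x) ⟨
    x * 0# + d * d    ≈⟨ +-congʳ (*-congˡ x+d≈0) ⟨
    x * (x + d) + d * d
      ≈⟨ solve 2 (λ x d → x :* (x :+ d) :+ d :* d := x :* x :+ d :* (x :+ d)) refl x d ⟩
    x * x + d * (x + d) ≈⟨ +-congˡ (*-congˡ x+d≈0) ⟩
    x * x + d * 0#    ≈⟨ +-congˡ (zeroʳ d) ⟩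
    x * x + 0#        ≈⟨ +-identityʳ (x * x) ⟩
    x * x             ∎

  0≤1 : 0# ≤ 1#
  0≤1 = ≤-trans (square-nonNegative 1#) (≤-reflexive (*-identityˡ 1#))

  square-mono-≤ : ∀ {x y} → 0# ≤ x → x ≤ y → x * x ≤ y * y
  square-mono-≤ 0≤x x≤y = ≤-trans (*-monoˡ-≤ 0≤x x≤y) (*-monoʳ-≤ (≤-trans 0≤x x≤y) x≤y)

  inverse-nonNegative : ∀ {z w} → 0# ≤ z → z * w ≈ 1# → 0# ≤ w
  inverse-nonNegative {z} {w} 0≤z zw≈1 = begin
    0#          ≤⟨ *-nonNegative 0≤z (square-nonNegative w) ⟩
    z * (w * w) ≈⟨ *-assoc z w w ⟨
    z * w * w   ≈⟨ *-congʳ zw≈1 ⟩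
    1# * w      ≈⟨ *-identityˡ w ⟩
    w           ∎

  *-cancelʳ-≤ : ∀ {x y z} → 0# ≤ z → ¬ (z ≈ 0#) → x * z ≤ y * z → x ≤ y
  *-cancelʳ-≤ {x} {y} {z} 0≤z z≉0 xz≤yz with w , zw≈1 ← inverse z z≉0 = begin
    x         ≈⟨ undo x ⟨
    x * z * w ≤⟨ *-monoʳ-≤ (inverse-nonNegative 0≤z zw≈1) xz≤yz ⟩
    y * z * w ≈⟨ undo y ⟩
    y         ∎
    where
    undo : ∀ x → x * z * w ≈ x
    undo x = trans (*-assoc x z w) (trans (*-congˡ zw≈1) (*-identityʳ x))

  square-cancel-≤ : ∀ {x y} → 0# ≤ y → x * x ≤ y * y → x ≤ y
  square-cancel-≤ {x} {y} 0≤y xx≤yy with total x y | x ≟ 0#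
  ... | inj₁ x≤y | _       = x≤y
  ... | inj₂ y≤x | yes x≈0 = ≤-trans (≤-reflexive x≈0) 0≤y
  -- Now x * x ≤ y * y ≤ y * x, and the positive factor x cancels.
  ... | inj₂ y≤x | no  x≉0 =
    *-cancelʳ-≤ (≤-trans 0≤y y≤x) x≉0 (≤-trans xx≤yy (*-monoˡ-≤ 0≤y y≤x))

  1≤⇒≉0 : ∀ {x} → 1# ≤ x → ¬ (x ≈ 0#)
  1≤⇒≉0 1≤x x≈0 = 0≉1 (antisym 0≤1 (≤-trans 1≤x (≤-reflexive x≈0)))

  -- This expansion and the next share the cross terms s k a + s k a. Comparing the square of (s k +
  -- a) / (s + k) with a therefore reduces to a rearrangement inequality in s², k² and a.
  expand-lower : ∀ s k a → (s * k + a) * (s * k + a) ≈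
                           s * s * (k * k) + a * a + (s * k * a + s * k * a)
  expand-lower = solve 3 (λ s k a → (s :* k :+ a) :* (s :* k :+ a) :=
    s :* s :* (k :* k) :+ a :* a :+ (s :* k :* a :+ s :* k :* a)) refl

  expand-upper : ∀ s k a → a * ((s + k) * (s + k)) ≈
                           a * (s * s) + a * (k * k) + (s * k * a + s * k * a)
  expand-upper = solve 3 (λ s k a → a :* ((s :+ k) :* (s :+ k)) :=
    a :* (s :* s) :+ a :* (k :* k) :+ (s :* k :* a :+ s :* k :* a)) refl

  -- (a − x)(y − a) ≥ 0, with both sides moved so that no subtraction occurs.
  rearrangement : ∀ {x y a} → x ≤ a → a ≤ y → x * y + a * a ≤ a * x + a * y
  rearrangement {x} {y} {a} x≤a a≤y
    with δ , 0≤δ , x+δ≈a ← gap x≤a | γ , 0≤γ , a+γ≈y ← gap a≤y =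
    x+y≈z⇒x≤z (*-nonNegative 0≤δ 0≤γ) (begin-equality
      x * y + a * a + δ * γ             ≈⟨ +-congʳ (+-congʳ (*-congˡ a+γ≈y)) ⟨
      x * (a + γ) + a * a + δ * γ       ≈⟨ identity x δ a γ ⟩
      a * x + (a * a + (x + δ) * γ)     ≈⟨ +-congˡ (+-congˡ (*-congʳ x+δ≈a)) ⟩
      a * x + (a * a + a * γ)           ≈⟨ +-congˡ (distribˡ a a γ) ⟨
      a * x + a * (a + γ)               ≈⟨ +-congˡ (*-congˡ a+γ≈y) ⟩
      a * x + a * y                     ∎)
    where
    identity : ∀ x δ a γ → x * (a + γ) + a * a + δ * γ ≈ a * x + (a * a + (x + δ) * γ)
    identity = solve 4 (λ x δ a γ → x :* (a :+ γ) :+ a :* a :+ δ :* γ :=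
      a :* x :+ (a :* a :+ (x :+ δ) :* γ)) refl

  -- The mirror case, where (x - a)(y - a) ≥ 0 because a lies below both numbers.
  rearrangement′ : ∀ {x y a} → a ≤ x → a ≤ y → a * x + a * y ≤ x * y + a * a
  rearrangement′ {x} {y} {a} a≤x a≤y
    with δ , 0≤δ , a+δ≈x ← gap a≤x | γ , 0≤γ , a+γ≈y ← gap a≤y =
    x+y≈z⇒x≤z (*-nonNegative 0≤δ 0≤γ) (begin-equality
      a * x + a * y + δ * γ                   ≈⟨ +-congʳ (+-cong (*-congˡ a+δ≈x) (*-congˡ a+γ≈y)) ⟨
      a * (a + δ) + a * (a + γ) + δ * γ       ≈⟨ identity δ a γ ⟩
      (a + δ) * (a + γ) + a * a               ≈⟨ +-congʳ (*-cong a+δ≈x a+γ≈y) ⟩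
      x * y + a * a                           ∎)
    where
    identity : ∀ δ a γ → a * (a + δ) + a * (a + γ) + δ * γ ≈ (a + δ) * (a + γ) + a * a
    identity = solve 3 (λ δ a γ → a :* (a :+ δ) :+ a :* (a :+ γ) :+ δ :* γ :=
      (a :+ δ) :* (a :+ γ) :+ a :* a) refl

  *-square : ∀ x y → (x * y) * (x * y) ≈ x * x * (y * y)
  *-square = solve 2 (λ x y → (x :* y) :* (x :* y) := x :* x :* (y :* y)) refl

  square-1+ : ∀ a → (1# + a) * (1# + a) ≈ a + (1# + a + a * a)
  square-1+ = solve 1 (λ a → (con 1 :+ a) :* (con 1 :+ a) := a :+ (con 1 :+ a :+ a :* a)) refl

  -- With k² ≥ a, the map t(s) = (s k + a) / (s + k) moves s towards √a without
  -- crossing it: t² − a = (s² − a)(k² − a) / (s + k)² and t − s = (a − s²) / (s + k).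
  module SquareRootStep {a s k t : Carrier} (0≤s+k : 0# ≤ s + k) (s+k≉0 : ¬ (s + k ≈ 0#))
    (a≤kk : a ≤ k * k) (t⟨s+k⟩≈sk+a : t * (s + k) ≈ s * k + a) where

    cancel-⟨s+k⟩² : ∀ {x y} → x * ((s + k) * (s + k)) ≤ y * ((s + k) * (s + k)) → x ≤ y
    cancel-⟨s+k⟩² {x} {y} p = *-cancelʳ-≤ 0≤s+k s+k≉0 (*-cancelʳ-≤ 0≤s+k s+k≉0 (begin
      x * (s + k) * (s + k)   ≈⟨ *-assoc x (s + k) (s + k) ⟩
      x * ((s + k) * (s + k)) ≤⟨ p ⟩
      y * ((s + k) * (s + k)) ≈⟨ *-assoc y (s + k) (s + k) ⟨
      y * (s + k) * (s + k)   ∎))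

    tt⟨s+k⟩² : t * t * ((s + k) * (s + k)) ≈ s * s * (k * k) + a * a + (s * k * a + s * k * a)
    tt⟨s+k⟩² = trans (sym (*-square t (s + k)))
      (trans (*-cong t⟨s+k⟩≈sk+a t⟨s+k⟩≈sk+a) (expand-lower s k a))

    stays-below : s * s ≤ a → t * t ≤ a
    stays-below ss≤a = cancel-⟨s+k⟩² (begin
      t * t * ((s + k) * (s + k))                           ≈⟨ tt⟨s+k⟩² ⟩
      s * s * (k * k) + a * a + (s * k * a + s * k * a)     ≤⟨ +-monoˡ-≤ _ (rearrangement ss≤a a≤kk) ⟩
      a * (s * s) + a * (k * k) + (s * k * a + s * k * a)   ≈⟨ expand-upper s k a ⟨
      a * ((s + k) * (s + k))                               ∎)

    stays-above : a ≤ s * s → a ≤ t * t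
    stays-above a≤ss = cancel-⟨s+k⟩² (begin
      a * ((s + k) * (s + k))                               ≈⟨ expand-upper s k a ⟩
      a * (s * s) + a * (k * k) + (s * k * a + s * k * a)   ≤⟨ +-monoˡ-≤ _ (rearrangement′ a≤ss a≤kk) ⟩
      s * s * (k * k) + a * a + (s * k * a + s * k * a)     ≈⟨ tt⟨s+k⟩² ⟨
      t * t * ((s + k) * (s + k))                           ∎)

    t≤s⇒a≤ss : t ≤ s → a ≤ s * s
    t≤s⇒a≤ss t≤s = +-cancelʳ-≤ (s * k) (begin
      a + s * k     ≈⟨ +-comm a (s * k) ⟩
      s * k + a     ≈⟨ t⟨s+k⟩≈sk+a ⟨
      t * (s + k)   ≤⟨ *-monoʳ-≤ 0≤s+k t≤s ⟩
      s * (s + k)   ≈⟨ distribˡ s s k ⟩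
      s * s + s * k ∎)

    s≤t⇒ss≤a : s ≤ t → s * s ≤ a
    s≤t⇒ss≤a s≤t = +-cancelʳ-≤ (s * k) (begin
      s * s + s * k ≈⟨ distribˡ s s k ⟨
      s * (s + k)   ≤⟨ *-monoʳ-≤ 0≤s+k s≤t ⟩
      t * (s + k)   ≈⟨ t⟨s+k⟩≈sk+a ⟩
      s * k + a     ≈⟨ +-comm (s * k) a ⟩
      a + s * k     ∎)

  -- The supremum s of { x ≥ 0 ∣ x² ≤ a } can neither be moved up nor down by t.
  square-root : ∀ {a} → 0# ≤ a → ∃ λ s → 0# ≤ s × s * s ≈ a
  square-root {a} 0≤a = root (complete Below (0# , below-0) (k , bounded k 0≤k a≤kk))
    where
    -- The `Lift` raises the predicate to the universe level that `complete` asks for.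
    Below : Carrier → Set (c ⊔ ℓ₁ ⊔ ℓ₂)
    Below x = Lift (c ⊔ ℓ₁ ⊔ ℓ₂) (0# ≤ x × x * x ≤ a)

    bounded : ∀ t → 0# ≤ t → a ≤ t * t → IsUpperBound _≤_ Below t
    bounded t 0≤t a≤tt x (lift (_ , xx≤a)) = square-cancel-≤ 0≤t (≤-trans xx≤a a≤tt)

    below-0 : Below 0#
    below-0 = lift (≤-refl , ≤-trans (≤-reflexive (zeroˡ 0#)) 0≤a)

    -- With this choice k² ≥ a for every a ≥ 0, and s + k ≥ 1, so that division by s + k is possible
    -- even when a and s are zero.
    k : Carrier
    k = 1# + a

    0≤k : 0# ≤ k
    0≤k = +-nonNegative 0≤1 0≤a

    a≤kk : a ≤ k * k
    a≤kk = x+y≈z⇒x≤z (+-nonNegative 0≤k (square-nonNegative a)) (sym (square-1+ a))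

    root : ∃ (IsSupremum _≤_ Below) → ∃ λ s → 0# ≤ s × s * s ≈ a
    root (s , upper , least) = s , 0≤s , antisym ss≤a a≤ss
      where
      0≤s : 0# ≤ s
      0≤s = upper 0# below-0

      0≤s+k : 0# ≤ s + k
      0≤s+k = +-nonNegative 0≤s 0≤k

      s+k≉0 : ¬ (s + k ≈ 0#)
      s+k≉0 = 1≤⇒≉0 (begin
        1#    ≤⟨ x≤x+y 0≤a ⟩
        k     ≤⟨ x≤x+y 0≤s ⟩
        k + s ≈⟨ +-comm k s ⟩
        s + k ∎)

      w t : Carrier
      w = proj₁ (inverse (s + k) s+k≉0)
      t = (s * k + a) * w

      ⟨s+k⟩w≈1 : (s + k) * w ≈ 1#
      ⟨s+k⟩w≈1 = proj₂ (inverse (s + k) s+k≉0)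

      0≤t : 0# ≤ t
      0≤t = *-nonNegative (+-nonNegative (*-nonNegative 0≤s 0≤k) 0≤a)
                          (inverse-nonNegative 0≤s+k ⟨s+k⟩w≈1)

      open SquareRootStep {a} {s} {k} {t} 0≤s+k s+k≉0 a≤kk (begin-equality
        (s * k + a) * w * (s + k)   ≈⟨ *-assoc (s * k + a) w (s + k) ⟩
        (s * k + a) * (w * (s + k)) ≈⟨ *-congˡ (trans (*-comm w (s + k)) ⟨s+k⟩w≈1) ⟩
        (s * k + a) * 1#            ≈⟨ *-identityʳ (s * k + a) ⟩
        s * k + a                   ∎)

      ss≤a : s * s ≤ a
      ss≤a with total (s * s) a
      ... | inj₁ ss≤a = ss≤a
      -- From a ≤ s² follows a ≤ t², so t bounds `Below` from above. Leastness of s gives s ≤ t, and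
      -- the step fails to decrease s only if s² ≤ a.
      ... | inj₂ a≤ss = s≤t⇒ss≤a (least t (bounded t 0≤t (stays-above a≤ss)))

      a≤ss : a ≤ s * s
      a≤ss = t≤s⇒a≤ss (upper t (lift (0≤t , stays-below ss≤a)))

-- Finite sums and maxima.

module FiniteSums {c ℓ₁ ℓ₂ : Level} (ℝ : CompleteOrderedField c ℓ₁ ℓ₂) where

  open CompleteOrderedField ℝ hiding (zero)
  open LinearAlgebra ℝ
  open OrderedField ℝ
  open SemiringSum semiring public
    using (sum; sum-cong-≋; sum-replicate; sum-replicate-zero; ∑-distrib-+; ∑-comm;
           *-distribˡ-sum; *-distribʳ-sum)
  open SemiringMult semiring public using (×-assoc-*) renaming (_×_ to _·_; ×-congʳ to ·-congʳ)
  open PartialOrderReasoning poset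

  sum-mono-≤ : ∀ {n} {u v : Vector Carrier n} → (∀ i → u i ≤ v i) → sum u ≤ sum v
  sum-mono-≤ {zero}  u≤v = ≤-refl
  sum-mono-≤ {suc n} u≤v = +-mono-≤ (u≤v zero) (sum-mono-≤ (u≤v ∘ suc))

  sum-zero : ∀ {n} {v : Vector Carrier n} → (∀ i → v i ≈ 0#) → sum v ≈ 0#
  sum-zero {n} v≈0 = trans (sum-cong-≋ v≈0) (sum-replicate-zero n)

  sum-nonNegative : ∀ {n} {v : Vector Carrier n} → (∀ i → 0# ≤ v i) → 0# ≤ sum v
  sum-nonNegative {n} 0≤v = ≤-trans (≤-reflexive (sym (sum-replicate-zero n))) (sum-mono-≤ 0≤v)

  ≤-sum : ∀ {n} {v : Vector Carrier n} → (∀ i → 0# ≤ v i) → ∀ i → v i ≤ sum v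
  ≤-sum 0≤v zero    = x≤x+y (sum-nonNegative (0≤v ∘ suc))
  ≤-sum 0≤v (suc i) = ≤-trans (≤-sum (0≤v ∘ suc) i)
    (≤-trans (x≤x+y (0≤v zero)) (≤-reflexive (+-comm _ _)))

  -- `S ∪ T` is the disjoint union of `S` and `T ─ S`. Only an index in `T` but not in `S` needs
  -- work: its term comes first on the left and has to move past the sum over `S`.
  sum-element-∪ : ∀ {n} (S T : Subset n) (g : Fin n → Carrier) →
    sum (g ∘ element (S ∪ T)) ≈ sum (g ∘ element S) + sum (g ∘ element (T ─ S))
  sum-element-∪ []            []            g = sym (+-identityˡ 0#)
  sum-element-∪ (inside  ∷ S) (_       ∷ T) g =
    trans (+-congˡ (sum-element-∪ S T (g ∘ suc))) (sym (+-assoc _ _ _))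
  sum-element-∪ (outside ∷ S) (outside ∷ T) g = sum-element-∪ S T (g ∘ suc)
  sum-element-∪ (outside ∷ S) (inside  ∷ T) g = begin-equality
    g zero + sum (g ∘ suc ∘ element (S ∪ T)) ≈⟨ +-congˡ (sum-element-∪ S T (g ∘ suc)) ⟩
    g zero + (s + t)                         ≈⟨ +-assoc (g zero) s t ⟨
    g zero + s + t                           ≈⟨ +-congʳ (+-comm (g zero) s) ⟩
    s + g zero + t                           ≈⟨ +-assoc s (g zero) t ⟩
    s + (g zero + t)                         ∎
    where
    s t : Carrier
    s = sum (g ∘ suc ∘ element S)
    t = sum (g ∘ suc ∘ element (T ─ S))

  -- The fold runs over the tail with the head as its starting value. The head and the other entries
  -- thus need separate inductions, both over a varying tail with the starting value fixed.
  ≤-maximumOrZero : ∀ {n} (v : Vector Carrier n) i → v i ≤ maximumOrZero v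
  ≤-maximumOrZero {suc n} v = λ { zero → base (tail v) ; (suc i) → rest (tail v) i }
    where
    max : ∀ {n} → Vector Carrier n → Carrier
    max = foldr ℝ-Max._⊔_ (head v)
    base : ∀ {n} (u : Vector Carrier n) → head v ≤ max u
    base {zero}  u = ≤-refl
    base {suc n} u = ≤-trans (base (tail u)) (ℝ-Max.x≤y⊔x (head u) (max (tail u)))
    rest : ∀ {n} (u : Vector Carrier n) i → u i ≤ max u
    rest u zero    = ℝ-Max.x≤x⊔y (head u) (max (tail u))
    rest u (suc i) = ≤-trans (rest (tail u) i) (ℝ-Max.x≤y⊔x (head u) (max (tail u)))

  sum≤n·maximumOrZero : ∀ {n} (v : Vector Carrier n) → sum v ≤ (n · 1#) * maximumOrZero v
  sum≤n·maximumOrZero {n} v = begin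
    sum v                        ≤⟨ sum-mono-≤ (≤-maximumOrZero v) ⟩
    sum {n} (λ _ → M)            ≈⟨ sum-replicate n ⟩
    n · M                        ≈⟨ ·-congʳ n (*-identityˡ M) ⟨
    n · (1# * M)                 ≈⟨ ×-assoc-* n 1# M ⟨
    (n · 1#) * M                 ∎
    where
    M : Carrier
    M = maximumOrZero v

-- Inner products, Cauchy-Schwarz and the spectral norm bound.

module Vectors {c ℓ₁ ℓ₂ : Level} (ℝ : CompleteOrderedField c ℓ₁ ℓ₂) where

  open CompleteOrderedField ℝ hiding (zero)
  open LinearAlgebra ℝ
  open OrderedField ℝ
  open FiniteSums ℝ
  open NaturalSolver commutativeSemiring using (solve; _:=_; _:+_; _:*_)
  open PartialOrderReasoning poset

  infix 4 _≈ᵥ_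
  _≈ᵥ_ : ∀ {n} → Vector Carrier n → Vector Carrier n → Set ℓ₁
  u ≈ᵥ v = ∀ i → u i ≈ v i

  infixl 6 _-ᵥ_
  _-ᵥ_ : ∀ {n} → Vector Carrier n → Vector Carrier n → Vector Carrier n
  (u -ᵥ v) i = u i - v i

  infixl 7 _·ᵥ_
  _·ᵥ_ : ∀ {n} → Carrier → Vector Carrier n → Vector Carrier n
  (x ·ᵥ v) i = x * v i

  ⟨_,_⟩ : ∀ {n} → Vector Carrier n → Vector Carrier n → Carrier
  ⟨ u , v ⟩ = sum (λ i → u i * v i)

  ‖_‖² : ∀ {n} → Vector Carrier n → Carrier
  ‖ v ‖² = ⟨ v , v ⟩

  dot-cong : ∀ {n} {u u′ v v′ : Vector Carrier n} → u ≈ᵥ u′ → v ≈ᵥ v′ → ⟨ u , v ⟩ ≈ ⟨ u′ , v′ ⟩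
  dot-cong u≈u′ v≈v′ = sum-cong-≋ λ i → *-cong (u≈u′ i) (v≈v′ i)

  dot-congˡ : ∀ {n} (u : Vector Carrier n) {v v′ : Vector Carrier n} →
              v ≈ᵥ v′ → ⟨ u , v ⟩ ≈ ⟨ u , v′ ⟩
  dot-congˡ u v≈v′ = sum-cong-≋ λ i → *-congˡ {u i} (v≈v′ i)

  dot-congʳ : ∀ {n} (v : Vector Carrier n) {u u′ : Vector Carrier n} →
              u ≈ᵥ u′ → ⟨ u , v ⟩ ≈ ⟨ u′ , v ⟩
  dot-congʳ v u≈u′ = sum-cong-≋ λ i → *-congʳ {v i} (u≈u′ i)

  dot-comm : ∀ {n} (u v : Vector Carrier n) → ⟨ u , v ⟩ ≈ ⟨ v , u ⟩
  dot-comm u v = sum-cong-≋ λ i → *-comm (u i) (v i)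

  dot-·ʳ : ∀ {n} x (u v : Vector Carrier n) → ⟨ u , x ·ᵥ v ⟩ ≈ x * ⟨ u , v ⟩
  dot-·ʳ x u v = trans (sum-cong-≋ λ i → swap (u i) x (v i))
    (sym (*-distribˡ-sum x (λ i → u i * v i)))
    where
    swap : ∀ a b c → a * (b * c) ≈ b * (a * c)
    swap = solve 3 (λ a b c → a :* (b :* c) := b :* (a :* c)) refl

  ‖·‖² : ∀ {n} x (v : Vector Carrier n) → ‖ x ·ᵥ v ‖² ≈ x * x * ‖ v ‖²
  ‖·‖² x v = trans (sum-cong-≋ λ i → *-square x (v i))
    (sym (*-distribˡ-sum (x * x) (λ i → v i * v i)))

  ‖‖²-nonNegative : ∀ {n} (v : Vector Carrier n) → 0# ≤ ‖ v ‖²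
  ‖‖²-nonNegative v = sum-nonNegative λ i → square-nonNegative (v i)

  -- Each square is squeezed between 0 and the vanishing sum, and a nonzero entry could be recovered
  -- from its square by its inverse.
  ‖‖²≈0⇒≈0 : ∀ {n} (v : Vector Carrier n) → ‖ v ‖² ≈ 0# → ∀ i → v i ≈ 0#
  ‖‖²≈0⇒≈0 v ‖v‖²≈0 i with v i ≟ 0#
  ... | yes vᵢ≈0 = vᵢ≈0
  ... | no  vᵢ≉0 with w , vᵢw≈1 ← inverse (v i) vᵢ≉0 = begin-equality
    v i               ≈⟨ *-identityʳ (v i) ⟨
    v i * 1#          ≈⟨ *-congˡ vᵢw≈1 ⟨
    v i * (v i * w)   ≈⟨ *-assoc (v i) (v i) w ⟨
    v i * v i * w     ≈⟨ *-congʳ vᵢvᵢ≈0 ⟩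
    0# * w            ≈⟨ zeroˡ w ⟩
    0#                ∎
    where
    vᵢvᵢ≈0 : v i * v i ≈ 0#
    vᵢvᵢ≈0 = antisym
      (≤-trans (≤-sum (λ j → square-nonNegative (v j)) i) (≤-reflexive ‖v‖²≈0))
      (square-nonNegative (v i))

  -- The sum is a separate vector `z` with a pointwise equation, so that decompositions known only
  -- up to `≈` can be used directly.
  dot-+ʳ : ∀ {n} (u v w : Vector Carrier n) {z : Vector Carrier n} → (∀ i → z i ≈ v i + w i) →
           ⟨ u , z ⟩ ≈ ⟨ u , v ⟩ + ⟨ u , w ⟩
  dot-+ʳ u v w z≈v+w =
    trans (sum-cong-≋ λ i → trans (*-congˡ (z≈v+w i)) (distribˡ (u i) (v i) (w i)))
          (∑-distrib-+ (λ i → u i * v i) (λ i → u i * w i))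

  dot--ʳ : ∀ {n} (u v w : Vector Carrier n) → ⟨ u , v -ᵥ w ⟩ ≈ ⟨ u , v ⟩ - ⟨ u , w ⟩
  dot--ʳ u v w = sym (x≈y+z⇒x-z≈y (dot-+ʳ u (v -ᵥ w) w λ i → sym (x-y+y≈x (v i) (w i))))

  -- Only one factor `z` is expanded in full. The mixed form leads both to Pythagoras and to the
  -- expansion of the squared norm of a difference without any subtraction.
  ‖+‖² : ∀ {n} (v w : Vector Carrier n) {z : Vector Carrier n} → (∀ i → z i ≈ v i + w i) →
         ‖ z ‖² ≈ ‖ v ‖² + ⟨ v , w ⟩ + ⟨ z , w ⟩
  ‖+‖² v w {z} z≈v+w = begin-equality
    ‖ z ‖²                                        ≈⟨ dot-+ʳ z v w z≈v+w ⟩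
    ⟨ z , v ⟩ + ⟨ z , w ⟩                         ≈⟨ +-congʳ (dot-comm z v) ⟩
    ⟨ v , z ⟩ + ⟨ z , w ⟩                         ≈⟨ +-congʳ (dot-+ʳ v v w z≈v+w) ⟩
    ‖ v ‖² + ⟨ v , w ⟩ + ⟨ z , w ⟩                ∎

  pythagoras : ∀ {n} (v w : Vector Carrier n) {z : Vector Carrier n} →
               (∀ i → z i ≈ v i + w i) → ⟨ v , w ⟩ ≈ 0# →
               ‖ z ‖² ≈ ‖ v ‖² + ‖ w ‖²
  pythagoras v w {z} z≈v+w v⊥w = begin-equality
    ‖ z ‖²                         ≈⟨ ‖+‖² v w z≈v+w ⟩
    ‖ v ‖² + ⟨ v , w ⟩ + ⟨ z , w ⟩ ≈⟨ +-congʳ (trans (+-congˡ v⊥w) (+-identityʳ _)) ⟩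
    ‖ v ‖² + ⟨ z , w ⟩             ≈⟨ +-congˡ (dot-comm z w) ⟩
    ‖ v ‖² + ⟨ w , z ⟩             ≈⟨ +-congˡ (dot-+ʳ w v w z≈v+w) ⟩
    ‖ v ‖² + (⟨ w , v ⟩ + ‖ w ‖²)  ≈⟨ +-congˡ (+-congʳ (trans (dot-comm w v) v⊥w)) ⟩
    ‖ v ‖² + (0# + ‖ w ‖²)         ≈⟨ +-congˡ (+-identityˡ _) ⟩
    ‖ v ‖² + ‖ w ‖²                ∎

  -- Expand ‖ x w − u ‖² ≥ 0.
  dot≤scaled-‖‖² : ∀ {n} {x} (u w : Vector Carrier n) → 0# ≤ x → ¬ (x ≈ 0#) →
                   ‖ u ‖² ≤ x * ⟨ w , u ⟩ → ⟨ w , u ⟩ ≤ x * ‖ w ‖²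
  dot≤scaled-‖‖² {x = x} u w 0≤x x≉0 ‖u‖²≤xq =
    -- After multiplying by x and adding ‖ u ‖², the left side is at most 2 x q by the hypothesis,
    -- and 2 x q ≤ x² ‖ w ‖² + ‖ u ‖² is the expanded square.
    *-cancelʳ-≤ 0≤x x≉0 (+-cancelʳ-≤ ‖ u ‖² (begin
      q * x + ‖ u ‖²                            ≤⟨ +-monoʳ-≤ _ ‖u‖²≤xq ⟩
      q * x + x * q                             ≈⟨ +-congʳ (trans (*-comm q x) xq≈⟨z,u⟩+‖u‖²) ⟩
      ⟨ z , u ⟩ + ‖ u ‖² + x * q                ≤⟨ x≤x+y (‖‖²-nonNegative z) ⟩
      ⟨ z , u ⟩ + ‖ u ‖² + x * q + ‖ z ‖²       ≈⟨ shuffle ⟨ z , u ⟩ ‖ u ‖² (x * q) ‖ z ‖² ⟩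
      ‖ z ‖² + ⟨ z , u ⟩ + x * q + ‖ u ‖²       ≈⟨ +-congʳ (+-congˡ ⟨xw,u⟩≈xq) ⟨
      ‖ z ‖² + ⟨ z , u ⟩ + ⟨ x ·ᵥ w , u ⟩ + ‖ u ‖² ≈⟨ +-congʳ (‖+‖² z u xw≈z+u) ⟨
      ‖ x ·ᵥ w ‖² + ‖ u ‖²                      ≈⟨ +-congʳ (trans (‖·‖² x w) (swap x ‖ w ‖²)) ⟩
      x * ‖ w ‖² * x + ‖ u ‖²                   ∎))
    where
    q : Carrier
    q = ⟨ w , u ⟩
    z : Vector Carrier _
    z = x ·ᵥ w -ᵥ u
    xw≈z+u : ∀ i → x * w i ≈ z i + u i
    xw≈z+u i = sym (x-y+y≈x (x * w i) (u i))
    ⟨xw,u⟩≈xq : ⟨ x ·ᵥ w , u ⟩ ≈ x * q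
    ⟨xw,u⟩≈xq = trans (dot-comm (x ·ᵥ w) u) (trans (dot-·ʳ x u w) (*-congˡ (dot-comm u w)))
    xq≈⟨z,u⟩+‖u‖² : x * q ≈ ⟨ z , u ⟩ + ‖ u ‖²
    xq≈⟨z,u⟩+‖u‖² = trans (sym ⟨xw,u⟩≈xq) (trans (dot-comm (x ·ᵥ w) u)
      (trans (dot-+ʳ u z u xw≈z+u) (+-congʳ (dot-comm u z))))
    shuffle : ∀ a b c d → a + b + c + d ≈ d + a + c + b
    shuffle = solve 4 (λ a b c d → a :+ b :+ c :+ d := d :+ a :+ c :+ b) refl
    swap : ∀ a b → a * a * b ≈ a * b * a
    swap = solve 2 (λ a b → a :* a :* b := a :* b :* a) refl

  -- Cauchy-Schwarz against a unit vector. The projection u = p x of v onto x satisfies ‖ u ‖² = p²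
  -- = ⟨ v , u ⟩, so the preceding lemma applies with factor 1.
  dot²≤‖‖² : ∀ {n} (x v : Vector Carrier n) → ‖ x ‖² ≈ 1# → ⟨ x , v ⟩ * ⟨ x , v ⟩ ≤ ‖ v ‖²
  dot²≤‖‖² x v ‖x‖²≈1 = begin
    p * p            ≈⟨ ⟨v,px⟩≈pp ⟨
    ⟨ v , p ·ᵥ x ⟩   ≤⟨ dot≤scaled-‖‖² (p ·ᵥ x) v 0≤1 (0≉1 ∘ sym) (≤-reflexive (begin-equality
      ‖ p ·ᵥ x ‖²          ≈⟨ ‖·‖² p x ⟩
      p * p * ‖ x ‖²       ≈⟨ *-congˡ ‖x‖²≈1 ⟩
      p * p * 1#           ≈⟨ *-comm (p * p) 1# ⟩
      1# * (p * p)         ≈⟨ *-congˡ ⟨v,px⟩≈pp ⟨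
      1# * ⟨ v , p ·ᵥ x ⟩  ∎)) ⟩
    1# * ‖ v ‖²      ≈⟨ *-identityˡ ‖ v ‖² ⟩
    ‖ v ‖²           ∎
    where
    p : Carrier
    p = ⟨ x , v ⟩
    ⟨v,px⟩≈pp : ⟨ v , p ·ᵥ x ⟩ ≈ p * p
    ⟨v,px⟩≈pp = trans (dot-·ʳ p v x) (*-congˡ (dot-comm v x))

  ⊛-·ᵥ : ∀ {m n} (A : Matrix m n) x v → A ⊛ (x ·ᵥ v) ≈ᵥ x ·ᵥ (A ⊛ v)
  ⊛-·ᵥ A x v i = dot-·ʳ x (A i) v

  ⊛-congʳ : ∀ {m n} {A B : Matrix m n} v → A ≋ B → A ⊛ v ≈ᵥ B ⊛ v
  ⊛-congʳ v A≋B i = dot-congʳ v (A≋B i)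

  ⊛-congˡ : ∀ {m n} (A : Matrix m n) {u v} → u ≈ᵥ v → A ⊛ u ≈ᵥ A ⊛ v
  ⊛-congˡ A u≈v i = dot-congˡ (A i) u≈v

  dot-⊛ : ∀ {m n} u (A : Matrix m n) v → ⟨ u , A ⊛ v ⟩ ≈ ⟨ A ᵀ ⊛ u , v ⟩
  dot-⊛ u A v = begin-equality
    sum (λ i → u i * sum (λ j → A i j * v j))
      ≈⟨ sum-cong-≋ (λ i → *-distribˡ-sum (u i) (λ j → A i j * v j)) ⟩
    sum (λ i → sum (λ j → u i * (A i j * v j))) ≈⟨ ∑-comm (λ i j → u i * (A i j * v j)) ⟩
    sum (λ j → sum (λ i → u i * (A i j * v j)))
      ≈⟨ sum-cong-≋ (λ j → sum-cong-≋ λ i → swap (u i) (A i j) (v j)) ⟩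
    sum (λ j → sum (λ i → A i j * u i * v j))
      ≈⟨ sum-cong-≋ (λ j → *-distribʳ-sum (v j) (λ i → A i j * u i)) ⟨
    sum (λ j → sum (λ i → A i j * u i) * v j)   ∎
    where
    swap : ∀ a b c → a * (b * c) ≈ b * a * c
    swap = solve 3 (λ a b c → a :* (b :* c) := b :* a :* c) refl

  -- Row i of `A ⊗ B` is `B ᵀ` applied to row i of `A`, so this is an instance of the adjointness
  -- `dot-⊛`.
  ⊗-⊛ : ∀ {m n k} (A : Matrix m n) (B : Matrix n k) v → (A ⊗ B) ⊛ v ≈ᵥ A ⊛ (B ⊛ v)
  ⊗-⊛ A B v i = trans (dot-congʳ v λ j → dot-comm (A i) (column B j)) (sym (dot-⊛ (A i) B v))

  -- The spectral norm is defined through unit vectors, so the general bound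
  -- normalises v by a square root d of ‖ v ‖², with inverse e.
  spectralNorm-bound : ∀ {m n} (A : Matrix m n) {s} → IsSpectralNorm A s →
                       ∀ v → ‖ A ⊛ v ‖² ≤ s * s * ‖ v ‖²
  spectralNorm-bound A {s} (s-upper , _) v = bound (‖ v ‖² ≟ 0#)
    where
    -- A vector of norm zero cannot be normalised, but then its entries vanish and so does its
    -- image.
    zero-case : ‖ v ‖² ≈ 0# → ‖ A ⊛ v ‖² ≤ s * s * ‖ v ‖²
    zero-case ‖v‖²≈0 = begin
      ‖ A ⊛ v ‖²     ≈⟨ sum-zero (λ i → trans (*-congʳ (Av≈0 i)) (zeroˡ ((A ⊛ v) i))) ⟩
      0#             ≤⟨ *-nonNegative (square-nonNegative s) (‖‖²-nonNegative v) ⟩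
      s * s * ‖ v ‖² ∎
      where
      Av≈0 : ∀ i → (A ⊛ v) i ≈ 0#
      Av≈0 i = sum-zero λ j → trans (*-congˡ (‖‖²≈0⇒≈0 v ‖v‖²≈0 j)) (zeroʳ (A i j))

    normalised : ∀ d e r → d * d ≈ ‖ v ‖² → d * e ≈ 1# → 0# ≤ r → r * r ≈ ‖ A ⊛ (e ·ᵥ v) ‖² →
                 ‖ A ⊛ v ‖² ≤ s * s * ‖ v ‖²
    normalised d e r dd≈‖v‖² de≈1 0≤r rr≈‖Aev‖² = begin
      ‖ A ⊛ v ‖²                   ≈⟨ *-identityˡ ‖ A ⊛ v ‖² ⟨
      1# * ‖ A ⊛ v ‖²              ≈⟨ *-congʳ dd⟨ee⟩≈1 ⟨
      d * d * (e * e) * ‖ A ⊛ v ‖² ≈⟨ *-assoc (d * d) (e * e) ‖ A ⊛ v ‖² ⟩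
      d * d * (e * e * ‖ A ⊛ v ‖²) ≈⟨ *-congˡ (‖·‖² e (A ⊛ v)) ⟨
      d * d * ‖ e ·ᵥ (A ⊛ v) ‖²    ≈⟨ *-congˡ (dot-cong (⊛-·ᵥ A e v) (⊛-·ᵥ A e v)) ⟨
      d * d * ‖ A ⊛ (e ·ᵥ v) ‖²    ≈⟨ *-congˡ rr≈‖Aev‖² ⟨
      d * d * (r * r)              ≤⟨ *-monoˡ-≤ (square-nonNegative d) (square-mono-≤ 0≤r r≤s) ⟩
      d * d * (s * s)              ≈⟨ *-comm (d * d) (s * s) ⟩
      s * s * (d * d)              ≈⟨ *-congˡ dd≈‖v‖² ⟩
      s * s * ‖ v ‖²               ∎
      where
      dd⟨ee⟩≈1 : d * d * (e * e) ≈ 1#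
      dd⟨ee⟩≈1 = trans (sym (*-square d e)) (trans (*-cong de≈1 de≈1) (*-identityˡ 1#))
      ev-unit : ‖ e ·ᵥ v ‖² ≈ 1#
      ev-unit = begin-equality
        ‖ e ·ᵥ v ‖²      ≈⟨ ‖·‖² e v ⟩
        e * e * ‖ v ‖²   ≈⟨ *-congˡ dd≈‖v‖² ⟨
        e * e * (d * d)  ≈⟨ *-comm (e * e) (d * d) ⟩
        d * d * (e * e)  ≈⟨ dd⟨ee⟩≈1 ⟩
        1#               ∎
      r≤s : r ≤ s
      r≤s = s-upper r (e ·ᵥ v , (0≤1 , trans (*-identityˡ 1#) (sym ev-unit)) , 0≤r , rr≈‖Aev‖²)

    nonzero-case : ¬ (‖ v ‖² ≈ 0#) → ‖ A ⊛ v ‖² ≤ s * s * ‖ v ‖²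
    nonzero-case ‖v‖²≉0 =
      let d , _ , dd≈‖v‖²    = square-root (‖‖²-nonNegative v)
          d≉0 d≈0            = ‖v‖²≉0 (trans (sym dd≈‖v‖²) (trans (*-congʳ d≈0) (zeroˡ d)))
          e , de≈1           = inverse d d≉0
          -- The supremum bounds only numbers that are norms, so the norm r of the image has to be
          -- exhibited before r ≤ s is available.
          r , 0≤r , rr≈‖Aev‖² = square-root (‖‖²-nonNegative (A ⊛ (e ·ᵥ v)))
      in normalised d e r dd≈‖v‖² de≈1 0≤r rr≈‖Aev‖²

    bound : Dec (‖ v ‖² ≈ 0#) → ‖ A ⊛ v ‖² ≤ s * s * ‖ v ‖²
    bound (yes ‖v‖²≈0) = zero-case ‖v‖²≈0
    bound (no  ‖v‖²≉0) = nonzero-case ‖v‖²≉0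

-- Orthogonal projections from pseudo-inverses.

module Projections {c ℓ₁ ℓ₂ : Level} (ℝ : CompleteOrderedField c ℓ₁ ℓ₂) where

  open CompleteOrderedField ℝ hiding (zero)
  open LinearAlgebra ℝ
  open OrderedField ℝ
  open FiniteSums ℝ
  open Vectors ℝ
  open PartialOrderReasoning poset

  module _ {m n : ℕ} {A : Matrix m n} {P : Matrix n m} (pinv : IsPseudoInverse A P) where

    open IsPseudoInverse pinv

    AP-selfAdjoint : ∀ u v → ⟨ u , (A ⊗ P) ⊛ v ⟩ ≈ ⟨ (A ⊗ P) ⊛ u , v ⟩
    AP-selfAdjoint u v = trans (dot-⊛ u (A ⊗ P) v)
      (dot-congʳ v (⊛-congʳ u AP-symmetric))

    -- ‖ APv ‖² = ⟨ Aᵀv , P(APv) ⟩ ≤ a ‖ Aᵀv ‖², because ‖ P(APv) ‖² ≤ a ‖ APv ‖².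
    ‖AP⊛‖²-bound : ∀ {a} → 0# ≤ a → ¬ (a ≈ 0#) → (∀ v → ‖ P ⊛ v ‖² ≤ a * ‖ v ‖²) →
                   ∀ v → ‖ (A ⊗ P) ⊛ v ‖² ≤ a * ‖ A ᵀ ⊛ v ‖²
    ‖AP⊛‖²-bound {a} 0≤a a≉0 bound v = begin
      ‖ Qv ‖²              ≈⟨ ⟨Aᵀv,PQv⟩≈‖Qv‖² ⟨
      ⟨ A ᵀ ⊛ v , P ⊛ Qv ⟩ ≤⟨ dot≤scaled-‖‖² (P ⊛ Qv) (A ᵀ ⊛ v) 0≤a a≉0 (begin
        ‖ P ⊛ Qv ‖²              ≤⟨ bound Qv ⟩
        a * ‖ Qv ‖²              ≈⟨ *-congˡ ⟨Aᵀv,PQv⟩≈‖Qv‖² ⟨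
        a * ⟨ A ᵀ ⊛ v , P ⊛ Qv ⟩ ∎) ⟩
      a * ‖ A ᵀ ⊛ v ‖²     ∎
      where
      Qv : Vector Carrier m
      Qv = (A ⊗ P) ⊛ v
      ⟨Aᵀv,PQv⟩≈‖Qv‖² : ⟨ A ᵀ ⊛ v , P ⊛ Qv ⟩ ≈ ‖ Qv ‖²
      ⟨Aᵀv,PQv⟩≈‖Qv‖² = begin-equality
        ⟨ A ᵀ ⊛ v , P ⊛ Qv ⟩ ≈⟨ dot-⊛ v A (P ⊛ Qv) ⟨
        ⟨ v , A ⊛ (P ⊛ Qv) ⟩ ≈⟨ dot-congˡ v (⊗-⊛ A P Qv) ⟨
        ⟨ v , (A ⊗ P) ⊛ Qv ⟩ ≈⟨ AP-selfAdjoint v Qv ⟩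
        ‖ Qv ‖²              ∎

  -- The column x itself is the test vector. Since A P x = p x for the single entry p of P x, while
  -- A P A = A gives A P x = x, it follows that p = 1 and P x is a unit vector. The width is tied to
  -- 1 by an equation because the size of a singleton is 1 only propositionally.
  unitColumn⇒1≤spectralNorm : ∀ {m k} (A : Matrix m k) (P : Matrix k m) {s} →
    k ≡ 1 → (∀ j → ‖ column A j ‖² ≈ 1#) → IsPseudoInverse A P → IsSpectralNorm P s → 1# ≤ s
  unitColumn⇒1≤spectralNorm {m} A P ≡.refl unit pinv (s-upper , _) =
    s-upper 1# (x , isUnit x ‖x‖²≈1 , isUnit (P ⊛ x) ‖Px‖²≈1)
    where
    open IsPseudoInverse pinv
    isUnit : ∀ {n} (v : Vector Carrier n) → ‖ v ‖² ≈ 1# → IsNorm v 1#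
    isUnit v eq = 0≤1 , trans (*-identityˡ 1#) (sym eq)
    x : Vector Carrier m
    x = column A zero
    ‖x‖²≈1 : ‖ x ‖² ≈ 1#
    ‖x‖²≈1 = unit zero
    p : Carrier
    p = (P ⊛ x) zero
    Qx≈px : ∀ i → ((A ⊗ P) ⊛ x) i ≈ p * x i
    Qx≈px i = trans (⊗-⊛ A P x i) (trans (+-identityʳ _) (*-comm (x i) p))
    p≈1 : p ≈ 1#
    p≈1 = begin-equality
      p                      ≈⟨ *-identityʳ p ⟨
      p * 1#                 ≈⟨ *-congˡ ‖x‖²≈1 ⟨
      p * ‖ x ‖²             ≈⟨ dot-·ʳ p x x ⟨
      ⟨ x , p ·ᵥ x ⟩         ≈⟨ dot-congˡ x Qx≈px ⟨
      ⟨ x , (A ⊗ P) ⊛ x ⟩    ≈⟨ dot-congˡ x (λ i → APA≋A i zero) ⟩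
      ‖ x ‖²                 ≈⟨ ‖x‖²≈1 ⟩
      1#                     ∎
    ‖Px‖²≈1 : ‖ P ⊛ x ‖² ≈ 1#
    ‖Px‖²≈1 = trans (+-identityʳ _) (trans (*-cong p≈1 p≈1) (*-identityˡ 1#))

-- Column-span projections and residuals.

module SparseRegression {c ℓ₁ ℓ₂ : Level} (ℝ : CompleteOrderedField c ℓ₁ ℓ₂) where

  open CompleteOrderedField ℝ hiding (zero)
  open LinearAlgebra ℝ
  open OrderedField ℝ
  open FiniteSums ℝ
  open Vectors ℝ
  open Projections ℝ
  open PartialOrderReasoning poset

  module _ {m n : ℕ} (X : Matrix m n) (unit : ∀ j → IsNorm (column X j) 1#)
    (X⁺ : (S : Subset n) → Matrix ∣ S ∣ m)
    (pinv : ∀ S → IsPseudoInverse (columns X S) (X⁺ S))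
    (‖X⁺‖₂ : Subset n → Carrier)
    (spectral : ∀ S → IsSpectralNorm (X⁺ S) (‖X⁺‖₂ S))
    (α : Carrier)
    (isMaximum : IsMaximum _≤_ (λ a → ∃ λ S → Nonempty S × a ≈ ‖X⁺‖₂ S * ‖X⁺‖₂ S) α)
    where

    Q : Subset n → Matrix m m
    Q S = columns X S ⊗ X⁺ S

    x : Fin n → Vector Carrier m
    x = column X

    ‖x‖²≈1 : ∀ i → ‖ x i ‖² ≈ 1#
    ‖x‖²≈1 i = trans (sym (proj₂ (unit i))) (*-identityˡ 1#)

    ‖X⁺‖²≤α : ∀ {S} → Nonempty S → ‖X⁺‖₂ S * ‖X⁺‖₂ S ≤ α
    ‖X⁺‖²≤α {S} nonempty = proj₂ isMaximum _ (S , nonempty , refl)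

    -- The maximum is attained at a nonempty set, which supplies an index i, and the singleton of i
    -- already has a pseudo-inverse of norm at least 1.
    1≤α : 1# ≤ α
    1≤α with _ , (i , _) , _ ← proj₁ isMaximum = begin
      1#                            ≈⟨ *-identityˡ 1# ⟨
      1# * 1#                       ≤⟨ square-mono-≤ 0≤1 1≤s ⟩
      ‖X⁺‖₂ ⁅ i ⁆ * ‖X⁺‖₂ ⁅ i ⁆     ≤⟨ ‖X⁺‖²≤α (i , x∈⁅x⁆ i) ⟩
      α                             ∎
      where
      1≤s : 1# ≤ ‖X⁺‖₂ ⁅ i ⁆
      1≤s = unitColumn⇒1≤spectralNorm (columns X ⁅ i ⁆) (X⁺ ⁅ i ⁆)
        (∣⁅x⁆∣≡1 i) (λ k → ‖x‖²≈1 (element ⁅ i ⁆ k)) (pinv ⁅ i ⁆) (spectral ⁅ i ⁆)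

    0≤α : 0# ≤ α
    0≤α = ≤-trans 0≤1 1≤α

    Q-selfAdjoint : ∀ S u v → ⟨ u , Q S ⊛ v ⟩ ≈ ⟨ Q S ⊛ u , v ⟩
    Q-selfAdjoint S = AP-selfAdjoint (pinv S)

    -- The first Penrose equation, read off at the column of `columns X S` that equals `x i`.
    Q-fixes : ∀ S {i} → i ∈ S → Q S ⊛ x i ≈ᵥ x i
    Q-fixes S i∈S j with k , ≡.refl ← element-surjective S i∈S = IsPseudoInverse.APA≋A (pinv S) j k

    -- `Q S ⊛ v` is a combination of columns indexed by `S`, each of which `Q U` fixes.
    Q-absorbs : ∀ S U → S ⊆ U → ∀ v → Q U ⊛ (Q S ⊛ v) ≈ᵥ Q S ⊛ v
    Q-absorbs S U S⊆U v i = begin-equality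
      (Q U ⊛ (Q S ⊛ v)) i             ≈⟨ ⊛-congˡ (Q U) (⊗-⊛ A (X⁺ S) v) i ⟩
      (Q U ⊛ (A ⊛ (X⁺ S ⊛ v))) i      ≈⟨ ⊗-⊛ (Q U) A (X⁺ S ⊛ v) i ⟨
      ((Q U ⊗ A) ⊛ (X⁺ S ⊛ v)) i
        ≈⟨ ⊛-congʳ (X⁺ S ⊛ v) (λ j k → Q-fixes U (S⊆U (element∈ S k)) j) i ⟩
      (A ⊛ (X⁺ S ⊛ v)) i              ≈⟨ ⊗-⊛ A (X⁺ S) v i ⟨
      (Q S ⊛ v) i                     ∎
      where
      A : Matrix m ∣ S ∣
      A = columns X S

    ‖Q⊛‖²-bound : ∀ S v → ‖ Q S ⊛ v ‖² ≤
      α * sum (λ k → ⟨ x (element S k) , v ⟩ * ⟨ x (element S k) , v ⟩)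
    ‖Q⊛‖²-bound S = ‖AP⊛‖²-bound (pinv S) 0≤α (1≤⇒≉0 1≤α) bound
      where
      bound : ∀ v → ‖ X⁺ S ⊛ v ‖² ≤ α * ‖ v ‖²
      bound v with nonempty? S
      ... | yes nonempty = ≤-trans (spectralNorm-bound (X⁺ S) (spectral S) v)
        (*-monoʳ-≤ (‖‖²-nonNegative v) (‖X⁺‖²≤α nonempty))
      -- The maximum α ranges over nonempty sets only. For the empty set `X⁺ S` has no rows, so the
      -- norm is an empty sum.
      ... | no empty = begin
        ‖ X⁺ S ⊛ v ‖² ≈⟨ sum-zero (λ k → ⊥-elim (empty (element S k , element∈ S k))) ⟩
        0#            ≤⟨ *-nonNegative 0≤α (‖‖²-nonNegative v) ⟩
        α * ‖ v ‖²    ∎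

    residual : Subset n → Vector Carrier m → Vector Carrier m
    residual S y = y -ᵥ Q S ⊛ y

    -- The normal equations of least squares: the self-adjoint projection is moved onto `x i`, which
    -- it fixes.
    x⊥residual : ∀ S {i} → i ∈ S → ∀ y → ⟨ x i , residual S y ⟩ ≈ 0#
    x⊥residual S {i} i∈S y = begin-equality
      ⟨ x i , residual S y ⟩            ≈⟨ dot--ʳ (x i) y (Q S ⊛ y) ⟩
      ⟨ x i , y ⟩ - ⟨ x i , Q S ⊛ y ⟩   ≈⟨ +-congˡ (-‿cong ⟨x,Qy⟩≈⟨x,y⟩) ⟩
      ⟨ x i , y ⟩ - ⟨ x i , y ⟩         ≈⟨ -‿inverseʳ ⟨ x i , y ⟩ ⟩
      0#                                ∎
      where
      ⟨x,Qy⟩≈⟨x,y⟩ : ⟨ x i , Q S ⊛ y ⟩ ≈ ⟨ x i , y ⟩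
      ⟨x,Qy⟩≈⟨x,y⟩ = trans (Q-selfAdjoint S (x i) y) (dot-congʳ y (Q-fixes S i∈S))

    -- By absorption the projected residual is Q_U y - Q_S y, which gives the splitting. The two
    -- parts are orthogonal because Q_U is self-adjoint and annihilates the residual of U.
    ‖residual‖²-decomposition : ∀ S U → S ⊆ U → ∀ y →
      ‖ residual S y ‖² ≈ ‖ residual U y ‖² + ‖ Q U ⊛ residual S y ‖²
    ‖residual‖²-decomposition S U S⊆U y =
      pythagoras (residual U y) (Q U ⊛ residual S y) split orthogonal
      where
      Q⊛residual : ∀ i → (Q U ⊛ residual S y) i ≈ (Q U ⊛ y) i - (Q S ⊛ y) i
      Q⊛residual i = trans (dot--ʳ (Q U i) y (Q S ⊛ y)) (+-congˡ (-‿cong (Q-absorbs S U S⊆U y i)))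
      split : ∀ i → residual S y i ≈ residual U y i + (Q U ⊛ residual S y) i
      split i = begin-equality
        y i - (Q S ⊛ y) i                                   ≈⟨ +-congʳ (x-y+y≈x (y i) ((Q U ⊛ y) i)) ⟨
        residual U y i + (Q U ⊛ y) i - (Q S ⊛ y) i
          ≈⟨ +-assoc (residual U y i) ((Q U ⊛ y) i) (- (Q S ⊛ y) i) ⟩
        residual U y i + ((Q U ⊛ y) i - (Q S ⊛ y) i)        ≈⟨ +-congˡ (Q⊛residual i) ⟨
        residual U y i + (Q U ⊛ residual S y) i             ∎
      Q⊛residual≈0 : ∀ i → (Q U ⊛ residual U y) i ≈ 0#
      Q⊛residual≈0 i = trans (dot--ʳ (Q U i) y (Q U ⊛ y))
        (trans (+-congˡ (-‿cong (Q-absorbs U U (λ i∈U → i∈U) y i))) (-‿inverseʳ ((Q U ⊛ y) i)))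
      orthogonal : ⟨ residual U y , Q U ⊛ residual S y ⟩ ≈ 0#
      orthogonal = trans (Q-selfAdjoint U (residual U y) (residual S y))
        (sum-zero λ i → trans (*-congʳ (Q⊛residual≈0 i)) (zeroˡ (residual S y i)))

    -- The objective and its decrease.

    module _ {l : ℕ} (Y : Matrix m l) where

      f : Subset n → Carrier
      f = objective X X⁺ Y

      y : Fin l → Vector Carrier m
      y = column Y

      gain : Subset n → Subset n → Carrier
      gain S U = sum λ j → ‖ Q U ⊛ residual S (y j) ‖²

      -- The Frobenius norm sums row by row. Exchanging the sums splits the objective into one
      -- regression problem for each column of `Y`.
      f≈sum : ∀ S → f S ≈ sum (λ j → ‖ residual S (y j) ‖²)
      f≈sum S = ∑-comm (λ i j → residual S (y j) i * residual S (y j) i)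

      0≤f : ∀ S → 0# ≤ f S
      0≤f S = ≤-trans (sum-nonNegative λ j → ‖‖²-nonNegative (residual S (y j)))
                      (≤-reflexive (sym (f≈sum S)))

      0≤gain : ∀ S U → 0# ≤ gain S U
      0≤gain S U = sum-nonNegative λ j → ‖‖²-nonNegative (Q U ⊛ residual S (y j))

      f-decomposition : ∀ S U → S ⊆ U → f S ≈ f U + gain S U
      f-decomposition S U S⊆U = begin-equality
        f S                                  ≈⟨ f≈sum S ⟩
        sum (λ j → ‖ residual S (y j) ‖²)
          ≈⟨ sum-cong-≋ (λ j → ‖residual‖²-decomposition S U S⊆U (y j)) ⟩
        sum (λ j → ‖ residual U (y j) ‖² + ‖ Q U ⊛ residual S (y j) ‖²)
          ≈⟨ ∑-distrib-+ (λ j → ‖ residual U (y j) ‖²) (λ j → ‖ Q U ⊛ residual S (y j) ‖²) ⟩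
        sum (λ j → ‖ residual U (y j) ‖²) + gain S U ≈⟨ +-congʳ (f≈sum U) ⟨
        f U + gain S U                       ∎

      f-difference : ∀ S U → S ⊆ U → f S - f U ≈ gain S U
      f-difference S U S⊆U =
        x≈y+z⇒x-z≈y (trans (f-decomposition S U S⊆U) (+-comm (f U) (gain S U)))

      correlation : Subset n → Fin n → Carrier
      correlation S i = sum λ j → ⟨ x i , residual S (y j) ⟩ * ⟨ x i , residual S (y j) ⟩

      correlation≈0 : ∀ S {i} → i ∈ S → correlation S i ≈ 0#
      correlation≈0 S {i} i∈S = sum-zero λ j →
        trans (*-congʳ (x⊥residual S i∈S (y j))) (zeroˡ ⟨ x i , residual S (y j) ⟩)

      correlation≤ : ∀ S i → correlation S i ≤ f S - f (S ∪ ⁅ i ⁆)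
      correlation≤ S i = begin
        correlation S i       ≤⟨ sum-mono-≤ (λ j → bound (residual S (y j))) ⟩
        gain S (S ∪ ⁅ i ⁆)    ≈⟨ f-difference S U (p⊆p∪q ⁅ i ⁆) ⟨
        f S - f (S ∪ ⁅ i ⁆)   ∎
        where
        U : Subset n
        U = S ∪ ⁅ i ⁆
        bound : ∀ r → ⟨ x i , r ⟩ * ⟨ x i , r ⟩ ≤ ‖ Q U ⊛ r ‖²
        bound r = begin
          ⟨ x i , r ⟩ * ⟨ x i , r ⟩                     ≈⟨ *-cong move move ⟩
          ⟨ x i , Q U ⊛ r ⟩ * ⟨ x i , Q U ⊛ r ⟩         ≤⟨ dot²≤‖‖² (x i) (Q U ⊛ r) (‖x‖²≈1 i) ⟩
          ‖ Q U ⊛ r ‖²                                  ∎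
          where
          move : ⟨ x i , r ⟩ ≈ ⟨ x i , Q U ⊛ r ⟩
          move = sym (trans (Q-selfAdjoint U (x i) r)
            (dot-congʳ r (Q-fixes U (q⊆p∪q S ⁅ i ⁆ (x∈⁅x⁆ i)))))

      gain≤ : ∀ S T → gain S (S ∪ T) ≤ α * sum (correlation S ∘ element (T ─ S))
      gain≤ S T = begin
        gain S (S ∪ T)
          ≤⟨ sum-mono-≤ (λ j → ‖Q⊛‖²-bound (S ∪ T) (residual S (y j))) ⟩
        sum (λ j → α * sum (λ k → square j (element (S ∪ T) k)))
          ≈⟨ *-distribˡ-sum α (λ j → sum (λ k → square j (element (S ∪ T) k))) ⟨
        α * sum (λ j → sum (λ k → square j (element (S ∪ T) k)))
          -- The exchange collects, for each column of `X`, its squared inner products with all the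
          -- residuals.
          ≈⟨ *-congˡ (∑-comm (λ j k → square j (element (S ∪ T) k))) ⟩
        α * sum (correlation S ∘ element (S ∪ T))
          ≈⟨ *-congˡ (sum-element-∪ S T (correlation S)) ⟩
        α * (sum (correlation S ∘ element S) + sum (correlation S ∘ element (T ─ S)))
          ≈⟨ *-congˡ (trans (+-congʳ (sum-zero λ k → correlation≈0 S (element∈ S k))) (+-identityˡ _)) ⟩
        α * sum (correlation S ∘ element (T ─ S)) ∎
        where
        square : Fin l → Fin n → Carrier
        square j i = ⟨ x i , residual S (y j) ⟩ * ⟨ x i , residual S (y j) ⟩

      weaklySupermodular : WeaklySupermodular α f
      weaklySupermodular = record
        { 1≤α = 1≤α
        ; nonNegative = 0≤f
        ; nonIncreasing = λ S T →
            x+y≈z⇒x≤z (0≤gain S (S ∪ T)) (sym (f-decomposition S (S ∪ T) (p⊆p∪q T)))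
        ; weakSupermodular = weakSupermodular
        }
        where
        weakSupermodular : ∀ S T → f S - f (S ∪ T) ≤ α * (∣ T ─ S ∣ · 1#) *
          maximumOrZero (λ k → f S - f (S ∪ ⁅ element (T ─ S) k ⁆))
        weakSupermodular S T = begin
          f S - f (S ∪ T)                                    ≈⟨ f-difference S (S ∪ T) (p⊆p∪q T) ⟩
          gain S (S ∪ T)                                     ≤⟨ gain≤ S T ⟩
          α * sum (correlation S ∘ element (T ─ S))          ≤⟨ *-monoˡ-≤ 0≤α (sum-mono-≤ correlations≤) ⟩
          -- If `T ─ S` is empty, both the sum and the product are zero, in agreement with the
          -- default value of `maximumOrZero`.
          α * sum decrease                                   ≤⟨ *-monoˡ-≤ 0≤α (sum≤n·maximumOrZero decrease) ⟩
          α * ((∣ T ─ S ∣ · 1#) * maximumOrZero decrease)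
            ≈⟨ *-assoc α (∣ T ─ S ∣ · 1#) (maximumOrZero decrease) ⟨
          α * (∣ T ─ S ∣ · 1#) * maximumOrZero decrease      ∎
          where
          decrease : Vector Carrier ∣ T ─ S ∣
          decrease k = f S - f (S ∪ ⁅ element (T ─ S) k ⁆)
          correlations≤ : ∀ k → correlation S (element (T ─ S) k) ≤ decrease k
          correlations≤ k = correlation≤ S (element (T ─ S) k)

lemma5 : {c ℓ₁ ℓ₂ : Level} (ℝ : CompleteOrderedField c ℓ₁ ℓ₂) →
    let open CompleteOrderedField ℝ
        open LinearAlgebra ℝ in
    (m n l : ℕ) (X : Matrix m n) (Y : Matrix m l) →
    (∀ j → IsNorm (column X j) 1#) →
    (X⁺ : (S : Subset n) → Matrix ∣ S ∣ m) →
    (∀ S → IsPseudoInverse (columns X S) (X⁺ S)) →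
    (‖X⁺‖₂ : Subset n → Carrier) →
    (∀ S → IsSpectralNorm (X⁺ S) (‖X⁺‖₂ S)) →
    (α : Carrier) →
    IsMaximum _≤_ (λ a → ∃ λ S → Nonempty S × a ≈ ‖X⁺‖₂ S * ‖X⁺‖₂ S) α →
    WeaklySupermodular α (objective X X⁺ Y)
lemma5 ℝ m n l X Y unit X⁺ pinv ‖X⁺‖₂ spectral α isMaximum =
  SparseRegression.weaklySupermodular ℝ X unit X⁺ pinv ‖X⁺‖₂ spectral α isMaximum Y
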